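{- $R_{C_3}(4,4,4)=R(3,3,3)+1$; that is, $R_{C_3}(4,4,4)=18$.
   Context: $C_3\le S_3$ denotes the cyclic group generated by $(1\,2\,3)$. A $3$-edge-coloured complete graph is a complete graph with each edge coloured from $\{1,2,3\}$. For $\pi\in C_3$ and a vertex $v$, switching at $v$ with $\pi$ recolours every edge incident with $v$ of colour $i$ to colour $\pi(i)$, leaving other edges unchanged. Two such graphs on the same vertex set are $C_3$-switch equivalent if one is obtained from the other by a finite sequence of switches. $K_t^{(i)}$ is a complete graph on $t$ vertices with all edges of colour $i$. $R_{C_3}(a_1,a_2,a_3)$ is the least $n$ such that every $3$-edge-coloured complete graph on $n$ vertices is $C_3$-switch equivalent to one containing, for some $i$, a copy of $K_{a_i}^{(i)}$. $R(3,3,3)=17$ is the classical $3$-colour Ramsey number. -}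

module Defs where

open import Data.Nat using (ℕ; _<_)
open import Data.Fin using (Fin; zero; suc; _≟_)
open import Data.Fin.Properties using ()
open import Data.Bool using (Bool; true; false; _xor_)
open import Data.List using (List; []; _∷_)
open import Data.Product using (Σ; _×_; _,_; ∃)
open import Relation.Nullary using (¬_; does)
open import Relation.Binary.PropositionalEquality using (_≡_; _≢_)
open import Function.Definitions using (Injective)

Colour : Set
Colour = Fin 3

-- An edge colouring of the complete graph on vertex set Fin n:
-- c i j is the colour of the edge {i,j} (i ≢ j); the diagonal is ignored.
Colouring : ℕ → Set
Colouring n = Fin n → Fin n → Colour

SymmetricColouring : {n : ℕ} → Colouring n → Set
SymmetricColouring {n} c = (i j : Fin n) → i ≢ j → c i j ≡ c j i

-- The cyclic group C₃ = ⟨(1 2 3)⟩; element k is the k-th power of (1 2 3),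
-- acting on colours by  x ↦ x + k (mod 3).
C₃ : Set
C₃ = Fin 3

cyc : Colour → Colour
cyc zero = suc zero
cyc (suc zero) = suc (suc zero)
cyc (suc (suc zero)) = zero

act : C₃ → Colour → Colour
act zero x = x
act (suc zero) x = cyc x
act (suc (suc zero)) x = cyc (cyc x)

switch : {n : ℕ} → Fin n → C₃ → Colouring n → Colouring n
switch v π c i j with does (i ≟ v) xor does (j ≟ v)
... | true  = act π (c i j)
... | false = c i j

applySwitches : {n : ℕ} → List (Fin n × C₃) → Colouring n → Colouring n
applySwitches [] c = c
applySwitches ((v , π) ∷ s) c = applySwitches s (switch v π c)

SwitchEquivalent : {n : ℕ} → Colouring n → Colouring n → Set
SwitchEquivalent {n} c d =
  Σ (List (Fin n × C₃)) λ s → (i j : Fin n) → i ≢ j → applySwitches s c i j ≡ d i j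

ContainsMono : {n : ℕ} → Colouring n → ℕ → Colour → Set
ContainsMono {n} c t col =
  Σ (Fin t → Fin n) λ f → Injective _≡_ _≡_ f ×
    ((x y : Fin t) → x ≢ y → c (f x) (f y) ≡ col)

C₃RamseyProperty : (Colour → ℕ) → ℕ → Set
C₃RamseyProperty a n =
  (c : Colouring n) → SymmetricColouring c →
  Σ (Colouring n) λ d → SwitchEquivalent c d ×
    Σ Colour λ col → ContainsMono d (a col) col

IsC₃RamseyNumber : (Colour → ℕ) → ℕ → Set
IsC₃RamseyNumber a r = C₃RamseyProperty a r × ((m : ℕ) → m < r → ¬ C₃RamseyProperty a m)

{-# OPTIONS --safe #-}

-- Upper bound: switching every other vertex makes all edges at a vertex v of one colour, and
-- switching at v then moves that colour freely without touching the other edges.  By R(3,3,3) ≤ 17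
-- the remaining 17 vertices span a monochromatic triangle, which v completes to a K₄.
-- Lower bound: reading colours in ℤ/3, switching replaces c i j by p i + p j + c i j, so in a
-- colouring switch equivalent to one with a monochromatic K₄ on {w,x,y,z} the three sums
-- c w x + c y z, c w y + c x z, c w z + c x y agree.  A circulant colouring of K₁₇ has no such
-- quadruple.
module Submission where

open import Defs
open import Data.Fin using (Fin; zero; suc; _≟_; toℕ; inject≤)
open import Data.Fin.Patterns using (0F; 1F; 2F; 3F)
open import Data.Fin.Properties using (all?; suc-injective; inject≤-injective)
open import Data.Bool using (if_then_else_)
open import Data.List using (List; []; _∷_; map; length; lookup; filter; allFin)
open import Data.List.Properties using (filter-notAll)
open import Data.List.Membership.Propositional using (_∈_; find)
open import Data.List.Membership.Propositional.Properties using (∈-filter⁺; ∈-allFin; ∈-lookup)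
open import Data.List.Relation.Unary.All as All using (All; []; _∷_)
open import Data.List.Relation.Unary.All.Properties using (all-filter; ¬Any⇒All¬)
open import Data.List.Relation.Unary.Any as Any using (here; there)
open import Data.List.Relation.Unary.AllPairs as AllPairs using (AllPairs; []; _∷_)
open import Data.List.Relation.Unary.AllPairs.Properties using (tabulate⁺)
open import Data.List.Relation.Binary.Sublist.Propositional
  using (_⊆_; []; _∷_; _∷ʳ_; ⊆-trans; from∈)
open import Data.List.Relation.Binary.Sublist.Propositional.Properties
  using (All-resp-⊆; filter-⊆)
open import Data.Nat using (ℕ; zero; suc; _+_; _*_; _≤_; _<_; s≤s; s≤s⁻¹; ∣_-_∣)
open import Data.Nat.Properties
  using (≤-refl; ≤-trans; ≤-<-trans; +-cancelˡ-<; +-monoˡ-≤; *-monoˡ-≤; _<?_; ≮⇒≥;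
         +-suc; ∣-∣-comm; module ≤-Reasoning)
open import Data.Product using (∃; ∃₂; _×_; _,_; proj₁; proj₂)
open import Data.Sum using (_⊎_; inj₁; inj₂)
open import Function using (_∘_; id)
open import Function.Definitions using (Injective)
open import Relation.Binary using (Rel; Symmetric)
open import Relation.Binary.PropositionalEquality
open import Relation.Nullary using (¬_; Dec; does; yes; no; ¬?; contradiction)
open import Relation.Nullary.Decidable using (from-yes; decidable-stable; _→-dec_)
open import Relation.Unary using (Pred; Decidable)
open import Relation.Unary.Properties using (∁?)

-- Arithmetic of `C₃` acting on colours.

inv : C₃ → C₃
inv 0F = 0F
inv 1F = 2F
inv 2F = 1F

act-identityʳ : ∀ p → act p 0F ≡ p
act-identityʳ = from-yes (all? λ p → act p 0F ≟ p)

act-inverseˡ : ∀ p → act (inv p) p ≡ 0F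
act-inverseˡ = from-yes (all? λ p → act (inv p) p ≟ 0F)

act-comm : ∀ p q x → act p (act q x) ≡ act q (act p x)
act-comm = from-yes (all? λ p → all? λ q → all? λ x → act p (act q x) ≟ act q (act p x))

-- Colours and group elements are both `Fin 3`, so `act` is addition in ℤ/3. This law folds the
-- effect of one switch into the potential of the later ones.
act-∙ : ∀ p q r s x → act p (act q (act r (act s x))) ≡ act (act r p) (act (act s q) x)
act-∙ = from-yes (all? λ p → all? λ q → all? λ r → all? λ s → all? λ x →
  act p (act q (act r (act s x))) ≟ act (act r p) (act (act s q) x))

act-transpose : ∀ p q x k → act p (act q x) ≡ k → x ≡ act (inv p) (act (inv q) k)
act-transpose = from-yes (all? λ p → all? λ q → all? λ x → all? λ k →
  (act p (act q x) ≟ k) →-dec (x ≟ act (inv p) (act (inv q) k)))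

act-exchange : ∀ p q r s k →
  act (act p (act q k)) (act r (act s k)) ≡ act (act p (act r k)) (act q (act s k))
act-exchange = from-yes (all? λ p → all? λ q → all? λ r → all? λ s → all? λ k →
  act (act p (act q k)) (act r (act s k)) ≟ act (act p (act r k)) (act q (act s k)))

-- Sequences of switches as potentials on the vertices.

kick : ∀ {n} → Fin n → C₃ → Fin n → C₃
kick v π i = if does (i ≟ v) then π else 0F

-- Distinct endpoints cannot both be `v`, so at most one kick is nontrivial; at a loop the `xor`
-- would cancel while the kicks would add up.
switch-kick : ∀ {n} (v : Fin n) π c i j → i ≢ j →
  switch v π c i j ≡ act (kick v π i) (act (kick v π j) (c i j))
switch-kick v π c i j i≢j with i ≟ v | j ≟ v
... | yes refl | yes refl = contradiction refl i≢j
... | yes _    | no _     = refl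
... | no _     | yes _    = refl
... | no _     | no _     = refl

potential : ∀ {n} → List (Fin n × C₃) → Fin n → C₃
potential []            i = 0F
potential ((v , π) ∷ s) i = act (kick v π i) (potential s i)

-- `C₃` is abelian, so only the total power applied at each endpoint matters, not the order of the
-- switches.
applySwitches-potential : ∀ {n} s (c : Colouring n) i j → i ≢ j →
  applySwitches s c i j ≡ act (potential s i) (act (potential s j) (c i j))
applySwitches-potential []            c i j i≢j = refl
applySwitches-potential ((v , π) ∷ s) c i j i≢j = begin
  applySwitches s (switch v π c) i j
    ≡⟨ applySwitches-potential s (switch v π c) i j i≢j ⟩
  act (potential s i) (act (potential s j) (switch v π c i j))
    ≡⟨ cong (act (potential s i) ∘ act (potential s j)) (switch-kick v π c i j i≢j) ⟩
  act (potential s i) (act (potential s j) (act (kick v π i) (act (kick v π j) (c i j))))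
    ≡⟨ act-∙ (potential s i) (potential s j) (kick v π i) (kick v π j) (c i j) ⟩
  act (potential ((v , π) ∷ s) i) (act (potential ((v , π) ∷ s) j) (c i j)) ∎
  where open ≡-Reasoning

shift : ∀ {n} → Fin n × C₃ → Fin (suc n) × C₃
shift (v , π) = suc v , π

potential-shift-zero : ∀ {n} (s : List (Fin n × C₃)) → potential (map shift s) zero ≡ 0F
potential-shift-zero []      = refl
potential-shift-zero (_ ∷ s) = potential-shift-zero s

potential-shift-suc : ∀ {n} (s : List (Fin n × C₃)) i →
  potential (map shift s) (suc i) ≡ potential s i
potential-shift-suc []            i = refl
potential-shift-suc ((v , π) ∷ s) i = cong (act (kick v π i)) (potential-shift-suc s i)

switches : ∀ {n} → (Fin n → C₃) → List (Fin n × C₃)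
switches {zero}  φ = []
switches {suc n} φ = (zero , φ zero) ∷ map shift (switches (φ ∘ suc))

-- `switches` visits each vertex exactly once. Every vertex function is thus a potential, and a
-- switch equivalence can be given by naming `φ` alone.
potential-switches : ∀ {n} (φ : Fin n → C₃) i → potential (switches φ) i ≡ φ i
potential-switches φ zero = begin
  act (φ zero) (potential (map shift (switches (φ ∘ suc))) zero)
    ≡⟨ cong (act (φ zero)) (potential-shift-zero (switches (φ ∘ suc))) ⟩
  act (φ zero) 0F
    ≡⟨ act-identityʳ (φ zero) ⟩
  φ zero ∎
  where open ≡-Reasoning
potential-switches φ (suc i) =
  trans (potential-shift-suc (switches (φ ∘ suc)) i) (potential-switches (φ ∘ suc) i)

-- Monochromatic triangles by the pigeonhole induction.

-- ramseyBound k + 1 is the usual bound on the k-colour Ramsey number of the triangle.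
ramseyBound : ℕ → ℕ
ramseyBound zero    = 1
ramseyBound (suc k) = suc (suc k * ramseyBound k)

module _ {a} {A : Set a} where

  length-filter+∁ : ∀ {p} {P : Pred A p} (P? : Decidable P) xs →
    length (filter P? xs) + length (filter (∁? P?) xs) ≡ length xs
  length-filter+∁ P? [] = refl
  length-filter+∁ P? (x ∷ xs) with P? x
  ... | yes _ = cong suc (length-filter+∁ P? xs)
  ... | no _  = trans (+-suc _ _) (cong suc (length-filter+∁ P? xs))

  AllPairs-resp-⊆ : ∀ {ℓ} {R : Rel A ℓ} {xs ys} → xs ⊆ ys → AllPairs R ys → AllPairs R xs
  AllPairs-resp-⊆ []         []       = []
  AllPairs-resp-⊆ (_ ∷ʳ τ)   (_ ∷ rs) = AllPairs-resp-⊆ τ rs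
  AllPairs-resp-⊆ (refl ∷ τ) (r ∷ rs) = All-resp-⊆ τ r ∷ AllPairs-resp-⊆ τ rs

  AllPairs-lookup : ∀ {ℓ} {R : Rel A ℓ} → Symmetric R → ∀ {xs} → AllPairs R xs →
    ∀ i j → i ≢ j → R (lookup xs i) (lookup xs j)
  AllPairs-lookup R-sym (r ∷ rs) zero    zero    i≢j = contradiction refl i≢j
  AllPairs-lookup R-sym (r ∷ rs) zero    (suc j) i≢j = All.lookup r (∈-lookup j)
  AllPairs-lookup R-sym (r ∷ rs) (suc i) zero    i≢j = R-sym (All.lookup r (∈-lookup i))
  AllPairs-lookup R-sym (r ∷ rs) (suc i) (suc j) i≢j =
    AllPairs-lookup R-sym rs i j (i≢j ∘ cong suc)

  -- Colours are tried in turn: a class of at most `m` elements is discarded together with its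
  -- colour, lowering the bound by `m`. Returning a sublist lets pairwise facts about `xs` carry
  -- over.
  pigeonhole : ∀ (h : A → Colour) m cs xs → All (λ x → h x ∈ cs) xs → length cs * m < length xs →
    ∃ λ col → col ∈ cs × ∃ λ ys → ys ⊆ xs × All (λ y → h y ≡ col) ys × m < length ys
  pigeonhole h m []         (x ∷ xs) (() ∷ _) _
  pigeonhole h m (col ∷ cs) xs       hxs∈cs   big with m <? length (filter ((_≟ col) ∘ h) xs)
  ... | yes m< = col , here refl , filter ((_≟ col) ∘ h) xs , filter-⊆ _ xs , all-filter _ xs , m<
  ... | no m≮ = widen (pigeonhole h m cs rest rest∈cs (+-cancelˡ-< m _ _ big-rest))
    where
    rest = filter (∁? ((_≟ col) ∘ h)) xs
    rest∈cs : All (λ x → h x ∈ cs) rest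
    rest∈cs = All.zipWith (λ (hx≢col , hx∈) → Any.tail hx≢col hx∈)
      (all-filter _ xs , All-resp-⊆ (filter-⊆ _ xs) hxs∈cs)
    widen : _ → _
    widen (col′ , col′∈cs , ys , ys⊆ , hys , m<ys) =
      col′ , there col′∈cs , ys , ⊆-trans ys⊆ (filter-⊆ _ xs) , hys , m<ys
    open ≤-Reasoning
    big-rest : m + length cs * m < m + length rest
    big-rest = begin-strict
      m + length cs * m                                    <⟨ big ⟩
      length xs                                            ≡⟨ length-filter+∁ ((_≟ col) ∘ h) xs ⟨
      length (filter ((_≟ col) ∘ h) xs) + length rest      ≤⟨ +-monoˡ-≤ (length rest) (≮⇒≥ m≮) ⟩
      m + length rest                                      ∎

  findPair : ∀ {ℓ} {R : Rel A ℓ} → (∀ x y → Dec (R x y)) → ∀ xs →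
    (∃₂ λ x y → (x ∷ y ∷ []) ⊆ xs × R x y) ⊎ AllPairs (λ x y → ¬ R x y) xs
  findPair R? []       = inj₂ []
  findPair R? (x ∷ xs) with Any.any? (R? x) xs | findPair R? xs
  ... | yes any | _ with y , y∈xs , r ← find any = inj₁ (x , y , refl ∷ from∈ y∈xs , r)
  ... | no _    | inj₁ (y , z , τ , r)           = inj₁ (y , z , x ∷ʳ τ , r)
  ... | no none | inj₂ rs                        = inj₂ (¬Any⇒All¬ xs none ∷ rs)

  -- The first vertex sends one colour to many later ones. An edge of that colour among them closes
  -- a triangle; otherwise they use one colour fewer. Only pairs in list order are inspected;
  -- symmetry enters in `ramsey-3-3-3`.
  monoTriangle : (c : A → A → Colour) → ∀ k cs xs → length cs ≤ k →
    AllPairs (λ x y → c x y ∈ cs) xs → ramseyBound k < length xs →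
    ∃ λ col → ∃ λ ts → ts ⊆ xs × AllPairs (λ x y → c x y ≡ col) ts × length ts ≡ 3
  -- Without colours no pair can exist, yet the bound 1 forces two vertices.
  monoTriangle c zero [] (_ ∷ _ ∷ _) _ ((() ∷ _) ∷ _) _
  monoTriangle c zero [] (_ ∷ [])    _ _              (s≤s ())
  monoTriangle c (suc k) cs (v ∷ xs) cs≤ (v∈cs ∷ xs∈cs) (s≤s big)
    with col , col∈cs , ys , ys⊆xs , vys , big-ys ←
      pigeonhole (c v) (ramseyBound k) cs xs v∈cs
        (≤-<-trans (*-monoˡ-≤ (ramseyBound k) cs≤) big)
    with findPair (λ x y → c x y ≟ col) ys
  ... | inj₁ (x , y , xy⊆ys , cxy) with cvx ∷ cvy ∷ [] ← All-resp-⊆ xy⊆ys vys =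
    col , v ∷ x ∷ y ∷ [] , refl ∷ ⊆-trans xy⊆ys ys⊆xs ,
    (cvx ∷ cvy ∷ []) ∷ (cxy ∷ []) ∷ [] ∷ [] , refl
  ... | inj₂ ys≢col
    with col′ , ts , ts⊆ys , tri ←
      monoTriangle c k (filter (¬? ∘ (_≟ col)) cs) ys
        -- The filter drops every copy of `col`, at least one, so the length bound is an inequality.
        (s≤s⁻¹ (≤-trans (filter-notAll _ cs (Any.map (λ eq ≢ → ≢ (sym eq)) col∈cs)) cs≤))
        (AllPairs.zipWith (λ (≢col , ∈cs) → ∈-filter⁺ _ ∈cs ≢col)
          (ys≢col , AllPairs-resp-⊆ ys⊆xs xs∈cs))
        big-ys
    = col′ , ts , v ∷ʳ ⊆-trans ts⊆ys ys⊆xs , tri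

ramsey-3-3-3 : (c : Colouring 17) → SymmetricColouring c → ∃ λ col → ContainsMono c 3 col
ramsey-3-3-3 c c-sym
  with col , ts@(_ ∷ _ ∷ _ ∷ []) , ts⊆ , mono , refl ←
    -- `ramseyBound 3` computes to 16, so the last `≤-refl` proves 16 < 17.
    monoTriangle c 3 (allFin 3) (allFin 17) ≤-refl (tabulate⁺ {f = id} λ _ → ∈-allFin _) ≤-refl
  = col , lookup ts ,
    (λ {x} {y} eq → decidable-stable (x ≟ y) λ x≢y → proj₁ (edge x y x≢y) eq) ,
    (λ x y x≢y → proj₂ (edge x y x≢y))
  where
  -- Distinctness is carried along because `c-sym` speaks only of distinct vertices; it also yields
  -- injectivity.
  R-sym : Symmetric (λ x y → x ≢ y × c x y ≡ col)
  R-sym (x≢y , cxy) = x≢y ∘ sym , trans (sym (c-sym _ _ x≢y)) cxy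
  edge : ∀ x y → x ≢ y → lookup ts x ≢ lookup ts y × c (lookup ts x) (lookup ts y) ≡ col
  edge = AllPairs-lookup R-sym (AllPairs.zip (AllPairs-resp-⊆ ts⊆ (tabulate⁺ {f = id} id) , mono))

-- Upper bound: coning over a monochromatic triangle.

cone : ∀ {n t col} (c : Colouring (suc n)) → SymmetricColouring c →
  (∀ i → c zero (suc i) ≡ col) → ContainsMono (λ i j → c (suc i) (suc j)) t col →
  ContainsMono c (suc t) col
cone {n} {t} {col} c c-sym apex (f , f-inj , f-mono) = g , g-inj , g-mono
  where
  g : Fin (suc t) → Fin (suc n)
  g zero    = zero
  g (suc x) = suc (f x)
  g-inj : Injective _≡_ _≡_ g
  g-inj {zero}  {zero}  _  = refl
  g-inj {suc x} {suc y} eq = cong suc (f-inj (suc-injective eq))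
  g-mono : ∀ x y → x ≢ y → c (g x) (g y) ≡ col
  g-mono zero    zero    x≢y = contradiction refl x≢y
  g-mono zero    (suc y) _   = apex (f y)
  g-mono (suc x) zero    _   = trans (c-sym _ _ λ ()) (apex (f x))
  g-mono (suc x) (suc y) x≢y = f-mono x y (x≢y ∘ cong suc)

twist : ∀ {n} → (Fin n → C₃) → Colouring n → Colouring n
twist φ c i j = act (φ i) (act (φ j) (c i j))

twist-symmetric : ∀ {n} φ {c : Colouring n} → SymmetricColouring c → SymmetricColouring (twist φ c)
twist-symmetric φ {c} c-sym i j i≢j =
  trans (act-comm (φ i) (φ j) (c i j)) (cong (act (φ j) ∘ act (φ i)) (c-sym i j i≢j))

twist-equivalent : ∀ {n} φ (c : Colouring n) → SwitchEquivalent c (twist φ c)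
twist-equivalent φ c = switches φ , λ i j i≢j →
  trans (applySwitches-potential (switches φ) c i j i≢j)
    (cong₂ (λ p q → act p (act q (c i j))) (potential-switches φ i) (potential-switches φ j))

c₃Ramsey-18 : C₃RamseyProperty (λ _ → 4) 18
c₃Ramsey-18 c c-sym = twist (φ col) c , twist-equivalent (φ col) c , col ,
  cone (twist (φ col) c) (twist-symmetric (φ col) c-sym) apex triangle
  where
  -- The inverses bring every edge at `zero` to colour `0F`; the value `k` at `zero` then moves them
  -- all to `k`.
  φ : Colour → Fin 18 → C₃
  φ k zero    = k
  φ k (suc i) = inv (c zero (suc i))
  -- `φ k (suc i)` does not depend on `k`, so the triangle found with `φ 0F` is definitionally one
  -- for `φ col`.
  link-sym : SymmetricColouring (λ i j → twist (φ 0F) c (suc i) (suc j))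
  link-sym i j i≢j = twist-symmetric (φ 0F) c-sym (suc i) (suc j) (i≢j ∘ suc-injective)
  col = proj₁ (ramsey-3-3-3 _ link-sym)
  triangle = proj₂ (ramsey-3-3-3 _ link-sym)
  apex : ∀ i → twist (φ col) c zero (suc i) ≡ col
  apex i = trans (cong (act col) (act-inverseˡ (c zero (suc i)))) (act-identityʳ col)

-- Lower bound: a circulant colouring on 17 vertices.

δ : ℕ → Colour
δ 3  = 1F
δ 5  = 1F
δ 6  = 2F
δ 7  = 2F
δ 10 = 2F
δ 11 = 2F
δ 12 = 1F
δ 14 = 1F
-- The default collects the nonzero squares mod 17; `1F` and `2F` are the cosets of the fourth
-- powers 1, 4, 13, 16 through 3 and 6.
δ _  = 0F

-- δ d = δ (17 ∸ d) for 0 < d < 17, so χ is invariant under rotation of ℤ/17.  Up to switching it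
-- is the colouring of the projective line over 𝔽₁₆ whose edges at ∞ have one colour and in which
-- {x,y} is coloured by the cubic residue class of x − y: the three matching sums of a quadruple agree
-- iff its cross-ratio λ and 1 − λ are both cubes, and in 𝔽₁₆ no two nonzero cubes sum to 1.
χ : Colouring 17
χ i j = δ ∣ toℕ i - toℕ j ∣

χ-symmetric : SymmetricColouring χ
χ-symmetric i j _ = cong δ (∣-∣-comm (toℕ i) (toℕ j))

-- A check of all quadruples, with distinctness tests interleaved so that degenerate tuples are
-- dropped early. The order in `χ z y` is the one `mono-balanced` gives when its last two vertices
-- are exchanged.
χ-unbalanced : ∀ w x → w ≢ x → ∀ y → w ≢ y → x ≢ y → ∀ z → w ≢ z → x ≢ z → y ≢ z →
  act (χ w x) (χ y z) ≡ act (χ w y) (χ x z) → act (χ w x) (χ z y) ≢ act (χ w z) (χ x y)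
χ-unbalanced = from-yes
  (all? λ w → all? λ x → ¬? (w ≟ x) →-dec
   all? λ y → ¬? (w ≟ y) →-dec (¬? (x ≟ y) →-dec
   all? λ z → ¬? (w ≟ z) →-dec (¬? (x ≟ z) →-dec (¬? (y ≟ z) →-dec
   ((act (χ w x) (χ y z) ≟ act (χ w y) (χ x z)) →-dec
    ¬? (act (χ w x) (χ z y) ≟ act (χ w z) (χ x y)))))))

-- Undoing the switches gives each edge the colour `p u + p v + col`, so both matchings sum to the
-- four values of `p` plus twice `col`.
mono-balanced : ∀ {n t col} (c : Colouring n) s → ((f , _) : ContainsMono (applySwitches s c) t col) →
  ∀ w x y z → w ≢ x → y ≢ z → w ≢ y → x ≢ z →
  act (c (f w) (f x)) (c (f y) (f z)) ≡ act (c (f w) (f y)) (c (f x) (f z))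
mono-balanced {col = col} c s (f , f-inj , f-mono) w x y z w≢x y≢z w≢y x≢z = begin
  act (c (f w) (f x)) (c (f y) (f z))
    ≡⟨ cong₂ act (edge w x w≢x) (edge y z y≢z) ⟩
  act (act (p w) (act (p x) col)) (act (p y) (act (p z) col))
    ≡⟨ act-exchange (p w) (p x) (p y) (p z) col ⟩
  act (act (p w) (act (p y) col)) (act (p x) (act (p z) col))
    ≡⟨ cong₂ act (edge w y w≢y) (edge x z x≢z) ⟨
  act (c (f w) (f y)) (c (f x) (f z)) ∎
  where
  open ≡-Reasoning
  p = inv ∘ potential s ∘ f
  edge : ∀ u v → u ≢ v → c (f u) (f v) ≡ act (p u) (act (p v) col)
  edge u v u≢v = act-transpose (potential s (f u)) (potential s (f v)) _ col
    (trans (sym (applySwitches-potential s c (f u) (f v) (u≢v ∘ f-inj))) (f-mono u v u≢v))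

¬c₃Ramsey : ∀ m → m ≤ 17 → ¬ C₃RamseyProperty (λ _ → 4) m
¬c₃Ramsey m m≤17 ramsey = refute (ramsey χ↾m χ↾m-symmetric)
  where
  -- Restricting `χ` to the first `m` vertices treats all `m ≤ 17` at once, since a balanced
  -- quadruple there would be one in `χ`.
  ι : Fin m → Fin 17
  ι i = inject≤ i m≤17
  ι-injective : Injective _≡_ _≡_ ι
  ι-injective = inject≤-injective m≤17 m≤17 _ _
  χ↾m : Colouring m
  χ↾m i j = χ (ι i) (ι j)
  χ↾m-symmetric : SymmetricColouring χ↾m
  χ↾m-symmetric i j i≢j = χ-symmetric (ι i) (ι j) (i≢j ∘ ι-injective)
  refute : ¬ (∃ λ d → SwitchEquivalent χ↾m d × ∃ λ col → ContainsMono d 4 col)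
  refute (d , (s , s≗d) , col , f , f-inj , f-mono) =
    χ-unbalanced _ _ (g-≢ 0F 1F λ ()) _ (g-≢ 0F 2F λ ()) (g-≢ 1F 2F λ ())
      _ (g-≢ 0F 3F λ ()) (g-≢ 1F 3F λ ()) (g-≢ 2F 3F λ ())
      (balanced 0F 1F 2F 3F (λ ()) (λ ()) (λ ()) (λ ()))
      (balanced 0F 1F 3F 2F (λ ()) (λ ()) (λ ()) (λ ()))
    where
    g-≢ : ∀ x y → x ≢ y → ι (f x) ≢ ι (f y)
    g-≢ x y x≢y = x≢y ∘ f-inj ∘ ι-injective
    balanced = mono-balanced {col = col} χ↾m s
      (f , f-inj , λ x y x≢y → trans (s≗d (f x) (f y) (x≢y ∘ f-inj)) (f-mono x y x≢y))

theorem26 : IsC₃RamseyNumber (λ (_ : Fin 3) → 4) 18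
theorem26 = c₃Ramsey-18 , λ m m<18 → ¬c₃Ramsey m (s≤s⁻¹ m<18)
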